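{- Let $r,s$ be positive integers with $1\le s<r/2$ such that $s,\ r-s,\ r+s,\ 2r-s$ are pairwise coprime, and define $p_4(n)$ by $$\sum_{n=0}^\infty p_4(n)q^n=\frac{1}{(1-q^s)(1-q^{r-s})(1-q^{r+s})(1-q^{2r-s})}.$$ Let $\Delta=s(r-s)(r+s)(2r-s)$. Then for all integers $n\ge 0$, $$p_4(n)=P_3(n)+C_4+Q(n),$$ where $$P_3(n)=\frac{n^3+6n^2r+n\left(21r^2+2rs-2s^2\right)/2}{6\Delta},$$ $C_4$ is a constant depending only on $r$ and $s$, and $Q$ is a periodic function of $n$ with period $\Delta$. -}

module Defs where

open import Data.Bool using (if_then_else_)
open import Data.Fin using (Fin; zero; suc; toℕ)
open import Data.Integer using (ℤ; +_; 0ℤ; 1ℤ)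
import Data.Integer as ℤ
import Data.Integer.Properties as ℤP
open import Data.List using (List; []; _∷_)
open import Data.List.Relation.Unary.All using (All; []; _∷_)
open import Data.Nat using (ℕ; zero; suc; _+_; _*_; _∸_; _^_; _≤_; _<_; _≡ᵇ_; NonZero; >-nonZero)
open import Data.Nat.Properties using (m*n≢0; m<n⇒0<n∸m; ≤-trans; m≤m+n; m≤n+m; ≤-<-trans; <-≤-trans)
open import Data.Rational using (ℚ; _/_)
import Data.Rational as ℚ
open import Data.Vec using (Vec; []; _∷_; head; lookup)
open import Relation.Binary.PropositionalEquality using (_≡_; _≗_; refl; sym; trans; cong; cong₂)

open import Algebra.Properties.Monoid.Sum ℤP.+-0-monoid using (sum-cong-≗; sum-syntax; sum⁺-syntax)

-- Formal power series in ℤ[[q]], given by their coefficients.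
Series : Set
Series = ℕ → ℤ

infixl 7 _⊛_

_⊛_ : Series → Series → Series
(f ⊛ g) n = ∑[ i ≤ n ] (f (toℕ i) ℤ.* g (n ∸ toℕ i))

q^_ : ℕ → Series
(q^ k) n = if n ≡ᵇ k then 1ℤ else 0ℤ

one : Series
one = q^ 0

1-q^_ : ℕ → Series
(1-q^ k) n = one n ℤ.- (q^ k) n

-- The coefficients gₙ , … , g₀ of 1/f when f has constant term 1, from
-- g₀ = 1 and gₙ₊₁ = - (f₁ gₙ + … + fₙ₊₁ g₀).
recipCoeffs : Series → (n : ℕ) → Vec ℤ (suc n)
recipCoeffs f zero    = 1ℤ ∷ []
recipCoeffs f (suc n) =
  ℤ.- (∑[ i ≤ n ] (f (suc (toℕ i)) ℤ.* lookup (recipCoeffs f n) i)) ∷ recipCoeffs f n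

-- Meaningful only for series with constant term 1; see recip-inverse.
recip : Series → Series
recip f n = head (recipCoeffs f n)

lookup-recipCoeffs : ∀ f n (i : Fin (suc n)) → lookup (recipCoeffs f n) i ≡ recip f (n ∸ toℕ i)
lookup-recipCoeffs f zero    zero    = refl
lookup-recipCoeffs f (suc n) zero    = refl
lookup-recipCoeffs f (suc n) (suc i) = lookup-recipCoeffs f n i

recip-inverse : ∀ f → f 0 ≡ 1ℤ → f ⊛ recip f ≗ one
recip-inverse f f₀ zero    rewrite f₀ = refl
recip-inverse f f₀ (suc n) rewrite f₀ =
  trans (cong₂ ℤ._+_ (ℤP.*-identityˡ (ℤ.- S)) (sym S≡)) (ℤP.+-inverseˡ S)
  where
  S : ℤ
  S = ∑[ i ≤ n ] (f (suc (toℕ i)) ℤ.* lookup (recipCoeffs f n) i)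
  S≡ : S ≡ ∑[ i ≤ n ] (f (suc (toℕ i)) ℤ.* recip f (n ∸ toℕ i))
  S≡ = sum-cong-≗
         (λ i → cong (f (suc (toℕ i)) ℤ.*_) (lookup-recipCoeffs f n i))

-- The truncated subtractions are genuine ones since s < r.
parts : ℕ → ℕ → List ℕ
parts r s = s ∷ r ∸ s ∷ r + s ∷ 2 * r ∸ s ∷ []

denominator : ℕ → ℕ → Series
denominator r s = (1-q^ s) ⊛ (1-q^ (r ∸ s)) ⊛ (1-q^ (r + s)) ⊛ (1-q^ (2 * r ∸ s))

p₄ : ℕ → ℕ → Series
p₄ r s = recip (denominator r s)

Δ : ℕ → ℕ → ℕ
Δ r s = s * (r ∸ s) * (r + s) * (2 * r ∸ s)

P₃ : (r s : ℕ) .{{_ : NonZero (Δ r s)}} → ℕ → ℚ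
P₃ r s n =
  ( + (n ^ 3 + 6 * n ^ 2 * r) / 1
      ℚ.+ (+ n ℤ.* (+ (21 * r ^ 2 + 2 * r * s) ℤ.- + (2 * s ^ 2))) / 2 )
    ℚ.* (1ℤ / (6 * Δ r s)) {{m*n≢0 6 (Δ r s)}}

Periodic : ℕ → (ℕ → ℚ) → Set
Periodic d Q = ∀ n → Q (n + d) ≡ Q n

module _ {r s : ℕ} (1≤s : 1 ≤ s) (2s<r : 2 * s < r) where

  private
    s<r : s < r
    s<r = ≤-<-trans (m≤m+n s (1 * s)) 2s<r

  parts-nonZero : All NonZero (parts r s)
  parts-nonZero =
      >-nonZero 1≤s
    ∷ >-nonZero (m<n⇒0<n∸m s<r)
    ∷ >-nonZero (≤-trans 1≤s (m≤n+m s r))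
    ∷ >-nonZero (m<n⇒0<n∸m (<-≤-trans s<r (m≤m+n r (1 * r))))
    ∷ []

  Δ-nonZero : NonZero (Δ r s)
  Δ-nonZero with a ∷ b ∷ c ∷ d ∷ [] ← parts-nonZero =
    m*n≢0 (s * (r ∸ s) * (r + s)) (2 * r ∸ s) {{m*n≢0 (s * (r ∸ s)) (r + s) {{m*n≢0 s (r ∸ s) {{a}} {{b}}}} {{c}}}} {{d}}

  p₄-correct : denominator r s ⊛ p₄ r s ≗ one
  p₄-correct with a ∷ b ∷ c ∷ d ∷ [] ← parts-nonZero =
    recip-inverse (denominator r s) (constant s (r ∸ s) (r + s) (2 * r ∸ s) {{a}} {{b}} {{c}} {{d}})
    where
    constant : ∀ a b c d .{{_ : NonZero a}} .{{_ : NonZero b}} .{{_ : NonZero c}} .{{_ : NonZero d}} →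
               ((1-q^ a) ⊛ (1-q^ b) ⊛ (1-q^ c) ⊛ (1-q^ d)) 0 ≡ 1ℤ
    constant (suc _) (suc _) (suc _) (suc _) = refl

{-# OPTIONS --safe #-}
module Submission where

-- Put the parts a, b, c, d into the denominator one at a time, and let v be the
-- coefficients of q^(σ−1) / ∏ (1 − q^aᵢ), σ the sum of the parts used so far.
-- Adding a part d gives v′(n + d) = v′(n) + v(n). With y = 2n + 2 − σ the functions
--   a v − 1,  2ab v − y,  24abc v − (3y² − a² − b² − c²),
--   48abcd v − (y³ − (a² + b² + c² + d²) y)
-- satisfy the same recursion up to a constant factor k: u′(n + d) = u′(n) + k u(n).
-- If u has period m, the product of the parts so far, and mean zero, and d is
-- coprime to m, then the sum of u over n, n + d, …, n + (m − 1)d is zero, so u′ has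
-- period md. The mean of u′ is zero since summing over windows of lengths a, b, …
-- turns 1 / ∏ (1 − q^aᵢ) into a power of 1 / (1 − q), whose coefficients match
-- the window sums of the subtracted polynomial.

open import Data.Integer using (ℤ; +_; 0ℤ; 1ℤ)
import Data.Integer as ℤ
import Data.Integer.Properties as ℤ
open import Data.Integer.Tactic.RingSolver using (solve-∀)
open import Data.List using (List; []; _∷_; length)
open import Data.List.Relation.Unary.All using ([]; _∷_)
open import Data.List.Relation.Unary.AllPairs using (AllPairs; []; _∷_)
open import Data.Nat using (ℕ; zero; suc; _^_; _<_; _≤_; s≤s; z≤n; NonZero)
import Data.Nat as ℕ
open import Data.Nat.Coprimality using (Coprime; coprime-Bézout; coprime-divisor; 1-coprimeTo)
open import Data.Nat.Divisibility using (∣-trans)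
open import Data.Nat.ListAction using (sum; product)
open import Data.Nat.GCD using (module Bézout)
import Data.Nat.Properties as ℕ
open import Data.Nat.Tactic.RingSolver using () renaming (solve-∀ to ℕ-solve-∀)
open import Data.Product using (_,_; _×_; Σ-syntax)
open import Data.Rational using (ℚ; fromℚᵘ; _/_)
import Data.Rational as ℚ
import Data.Rational.Properties as ℚ
open import Data.Rational.Unnormalised using (mkℚᵘ; *≡*)
import Data.Rational.Unnormalised as ℚᵘ
import Data.Rational.Unnormalised.Properties as ℚᵘ
open import Function using (_∘_)
open import Relation.Binary.PropositionalEquality

open import Defs

module _ where

  open import Data.Integer using (_+_; _*_; _-_; -_)

  -- Convolution of power series

  -- Induction on n works because `(f ⊛ h) (suc n)` unfolds to
  -- `f 0 * h (suc n) + ((f ∘ suc) ⊛ h) n`: peeling off a term replaces f by its tail.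
  ⊛-congʳ : ∀ h {f g} → f ≗ g → f ⊛ h ≗ g ⊛ h
  ⊛-congʳ h f≗g zero    = cong (λ x → x * h 0 + 0ℤ) (f≗g 0)
  ⊛-congʳ h f≗g (suc n) = cong₂ _+_ (cong (_* h (suc n)) (f≗g 0)) (⊛-congʳ h (f≗g ∘ suc) n)

  ⊛-linearˡ : ∀ k f g h → (λ n → k * f n + g n) ⊛ h ≗ λ n → k * (f ⊛ h) n + (g ⊛ h) n
  ⊛-linearˡ k f g h zero    = lemma k (f 0) (g 0) (h 0)
    where
    lemma : ∀ k x y z → (k * x + y) * z + 0ℤ ≡ k * (x * z + 0ℤ) + (y * z + 0ℤ)
    lemma = solve-∀
  ⊛-linearˡ k f g h (suc n) =
    trans (cong (_+_ ((k * f 0 + g 0) * h (suc n))) (⊛-linearˡ k (f ∘ suc) (g ∘ suc) h n))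
          (lemma k (f 0) (g 0) (h (suc n)) _ _)
    where
    lemma : ∀ k x y z X Y → (k * x + y) * z + (k * X + Y) ≡ k * (x * z + X) + (y * z + Y)
    lemma = solve-∀

  -- The tail of `f ⊛ g` is `f 0` times the tail of g plus `(f ∘ suc) ⊛ g`, so linearity in the left
  -- factor reduces the claim to the tail of f.
  ⊛-assoc : ∀ f g h → (f ⊛ g) ⊛ h ≗ f ⊛ (g ⊛ h)
  ⊛-assoc f g h zero    = lemma (f 0) (g 0) (h 0)
    where
    lemma : ∀ x y z → (x * y + 0ℤ) * z + 0ℤ ≡ x * (y * z + 0ℤ) + 0ℤ
    lemma = solve-∀
  ⊛-assoc f g h (suc n) =
    trans (cong (_+_ ((f 0 * g 0 + 0ℤ) * h (suc n)))
            (trans (⊛-linearˡ (f 0) (g ∘ suc) ((f ∘ suc) ⊛ g) h n)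
                   (cong (_+_ (f 0 * ((g ∘ suc) ⊛ h) n)) (⊛-assoc (f ∘ suc) g h n))))
          (lemma (f 0) (g 0) (h (suc n)) _ _)
    where
    lemma : ∀ x y z X Y → (x * y + 0ℤ) * z + (x * X + Y) ≡ x * (y * z + X) + Y
    lemma = solve-∀

  shift : ℕ → Series → Series
  shift zero    f n       = f n
  shift (suc k) f zero    = 0ℤ
  shift (suc k) f (suc n) = shift k f n

  q^-⊛ : ∀ k f → (q^ k) ⊛ f ≗ shift k f
  q^-⊛ zero    f zero    = trans (ℤ.+-identityʳ _) (ℤ.*-identityˡ (f 0))
  q^-⊛ zero    f (suc n) = trans (cong₂ _+_ (ℤ.*-identityˡ (f (suc n))) (0-⊛ n)) (ℤ.+-identityʳ _)
    where
    0-⊛ : ∀ n → ((λ _ → 0ℤ) ⊛ f) n ≡ 0ℤ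
    0-⊛ zero    = refl
    0-⊛ (suc n) = trans (ℤ.+-identityˡ _) (0-⊛ n)
  q^-⊛ (suc k) f zero    = refl
  q^-⊛ (suc k) f (suc n) = trans (ℤ.+-identityˡ _) (q^-⊛ k f n)

  1-q^-⊛ : ∀ k f n → f n ≡ shift k f n + ((1-q^ k) ⊛ f) n
  1-q^-⊛ k f n = sym (begin
    shift k f n + ((1-q^ k) ⊛ f) n                         ≡⟨ cong (_+_ (shift k f n)) (⊛-congʳ f one-q^ n) ⟩
    shift k f n + ((λ i → - 1ℤ * (q^ k) i + one i) ⊛ f) n  ≡⟨ cong (_+_ (shift k f n)) (⊛-linearˡ (- 1ℤ) (q^ k) one f n) ⟩
    shift k f n + (- 1ℤ * ((q^ k) ⊛ f) n + (one ⊛ f) n)    ≡⟨ cong₂ (λ x y → shift k f n + (- 1ℤ * x + y)) (q^-⊛ k f n) (q^-⊛ 0 f n) ⟩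
    shift k f n + (- 1ℤ * shift k f n + f n)               ≡⟨ cancel (shift k f n) (f n) ⟩
    f n                                                    ∎)
    where
    open ≡-Reasoning
    cancel : ∀ x y → x + (- 1ℤ * x + y) ≡ y
    cancel = solve-∀
    one-q^ : (1-q^ k) ≗ λ i → - 1ℤ * (q^ k) i + one i
    one-q^ i = lemma (one i) ((q^ k) i)
      where
      lemma : ∀ x y → x - y ≡ - 1ℤ * y + x
      lemma = solve-∀

  shift-+ : ∀ d N f n → shift (d ℕ.+ N) f (suc (d ℕ.+ n)) ≡ shift N f (suc n)
  shift-+ zero    N f n = refl
  shift-+ (suc d) N f n = shift-+ d N f n

  shift-cancel : ∀ N f n → shift N f (N ℕ.+ n) ≡ f n
  shift-cancel zero    f n = refl
  shift-cancel (suc N) f n = shift-cancel N f n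

  -- The identity g = q^d g + (1 - q^d) g, multiplied by q^N.
  shift-1-q^ : ∀ d N f g → (1-q^ d) ⊛ g ≗ f → shift N g ≗ λ n → shift (d ℕ.+ N) g n + shift N f n
  shift-1-q^ d zero    f g eq n rewrite ℕ.+-identityʳ d = trans (1-q^-⊛ d g n) (cong (_+_ (shift d g n)) (eq n))
  shift-1-q^ d (suc N) f g eq zero    rewrite ℕ.+-suc d N = refl
  shift-1-q^ d (suc N) f g eq (suc n) rewrite ℕ.+-suc d N = shift-1-q^ d N f g eq n

  -- Sums along arithmetic progressions

  [x+y]+z≡y+[x+z] : ∀ x y z → x ℕ.+ y ℕ.+ z ≡ y ℕ.+ (x ℕ.+ z)
  [x+y]+z≡y+[x+z] x y z = trans (cong (ℕ._+ z) (ℕ.+-comm x y)) (ℕ.+-assoc y x z)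

  stepSum : (d m : ℕ) → Series → Series
  stepSum d zero    f n = 0ℤ
  stepSum d (suc m) f n = f n + stepSum d m f (d ℕ.+ n)

  stepSum-cong : ∀ d m {f g} → f ≗ g → stepSum d m f ≗ stepSum d m g
  stepSum-cong d zero    f≗g n = refl
  stepSum-cong d (suc m) f≗g n = cong₂ _+_ (f≗g n) (stepSum-cong d m f≗g (d ℕ.+ n))

  stepSum-const : ∀ d m k n → stepSum d m (λ _ → k) n ≡ + m * k
  stepSum-const d zero    k n = refl
  stepSum-const d (suc m) k n =
    trans (cong (_+_ k) (stepSum-const d m k (d ℕ.+ n))) (sym (ℤ.suc-* (+ m) k))

  stepSum-linear : ∀ d m k f g →
    stepSum d m (λ n → k * f n + g n) ≗ λ n → k * stepSum d m f n + stepSum d m g n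
  stepSum-linear d zero    k f g n = sym (trans (ℤ.+-identityʳ _) (ℤ.*-zeroʳ k))
  stepSum-linear d (suc m) k f g n =
    trans (cong (_+_ (k * f n + g n)) (stepSum-linear d m k f g (d ℕ.+ n))) (lemma k (f n) (g n) _ _)
    where
    lemma : ∀ k x y X Y → (k * x + y) + (k * X + Y) ≡ k * (x + X) + (y + Y)
    lemma = solve-∀

  stepSum-translate : ∀ d m e f n → stepSum d m (f ∘ (e ℕ.+_)) n ≡ stepSum d m f (e ℕ.+ n)
  stepSum-translate d zero    e f n = refl
  stepSum-translate d (suc m) e f n = cong (_+_ (f (e ℕ.+ n)))
    (trans (stepSum-translate d m e f (d ℕ.+ n))
           (cong (stepSum d m f) (trans (sym (ℕ.+-assoc e d n)) ([x+y]+z≡y+[x+z] e d n))))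

  stepSum-comm : ∀ d m e k f → stepSum d m (stepSum e k f) ≗ stepSum e k (stepSum d m f)
  stepSum-comm d m e zero    f n = trans (stepSum-const d m 0ℤ n) (ℤ.*-zeroʳ (+ m))
  stepSum-comm d m e (suc k) f n = begin
    stepSum d m (λ i → f i + stepSum e k f (e ℕ.+ i)) n
      ≡⟨ stepSum-cong d m (λ i → cong (_+ stepSum e k f (e ℕ.+ i)) (sym (ℤ.*-identityˡ (f i)))) n ⟩
    stepSum d m (λ i → 1ℤ * f i + stepSum e k f (e ℕ.+ i)) n
      ≡⟨ stepSum-linear d m 1ℤ f (stepSum e k f ∘ (e ℕ.+_)) n ⟩
    1ℤ * stepSum d m f n + stepSum d m (stepSum e k f ∘ (e ℕ.+_)) n
      ≡⟨ cong₂ _+_ (ℤ.*-identityˡ (stepSum d m f n)) (stepSum-translate d m e (stepSum e k f) n) ⟩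
    stepSum d m f n + stepSum d m (stepSum e k f) (e ℕ.+ n)
      ≡⟨ cong (_+_ (stepSum d m f n)) (stepSum-comm d m e k f (e ℕ.+ n)) ⟩
    stepSum d m f n + stepSum e k (stepSum d m f) (e ℕ.+ n)
      ∎
    where open ≡-Reasoning

  -- The increments k f(n), k f(n + d), ... accumulate. Once the progression sum of f is known to
  -- vanish, g has period md.
  stepSum-telescope : ∀ d m k (f g : Series) → (∀ n → g (d ℕ.+ n) ≡ g n + k * f n) →
    ∀ n → g (m ℕ.* d ℕ.+ n) ≡ g n + k * stepSum d m f n
  stepSum-telescope d zero    k f g step n = lemma (g n) k
    where
    lemma : ∀ x k → x ≡ x + k * 0ℤ
    lemma = solve-∀
  stepSum-telescope d (suc m) k f g step n = begin
    g (d ℕ.+ m ℕ.* d ℕ.+ n)                                  ≡⟨ cong g ([x+y]+z≡y+[x+z] d (m ℕ.* d) n) ⟩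
    g (m ℕ.* d ℕ.+ (d ℕ.+ n))                                ≡⟨ stepSum-telescope d m k f g step (d ℕ.+ n) ⟩
    g (d ℕ.+ n) + k * stepSum d m f (d ℕ.+ n)                ≡⟨ cong (_+ k * stepSum d m f (d ℕ.+ n)) (step n) ⟩
    g n + k * f n + k * stepSum d m f (d ℕ.+ n)              ≡⟨ lemma (g n) k (f n) _ ⟩
    g n + k * (f n + stepSum d m f (d ℕ.+ n))                ∎
    where
    open ≡-Reasoning
    lemma : ∀ x k y z → x + k * y + k * z ≡ x + k * (y + z)
    lemma = solve-∀

  -- Moving the progression on by d drops its first term and gains the one just past its end.
  stepSum-next : ∀ d m f n → stepSum d m f (d ℕ.+ n) ≡ stepSum d m f n + (f (m ℕ.* d ℕ.+ n) - f n)
  stepSum-next d zero    f n = lemma (f n)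
    where
    lemma : ∀ x → 0ℤ ≡ 0ℤ + (x - x)
    lemma = solve-∀
  stepSum-next d (suc m) f n rewrite [x+y]+z≡y+[x+z] d (m ℕ.* d) n =
    trans (cong (_+_ (f (d ℕ.+ n))) (stepSum-next d m f (d ℕ.+ n))) (lemma (f n) (f (d ℕ.+ n)) _ (f (m ℕ.* d ℕ.+ (d ℕ.+ n))))
    where
    lemma : ∀ x y S z → y + (S + (z - y)) ≡ x + S + (z - x)
    lemma = solve-∀

  -- In the window 0, ..., k the series q^k g has at most one nonzero coefficient, the one at k.
  stepSum-shift : ∀ k g → stepSum 1 (suc k) (shift k g) 0 ≡ g 0
  stepSum-shift zero    g = ℤ.+-identityʳ (g 0)
  stepSum-shift (suc k) g = begin
    0ℤ + stepSum 1 (suc k) (shift (suc k) g) 1  ≡⟨ ℤ.+-identityˡ _ ⟩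
    stepSum 1 (suc k) (shift (suc k) g) 1       ≡⟨ stepSum-translate 1 (suc k) 1 (shift (suc k) g) 0 ⟨
    stepSum 1 (suc k) (shift k g) 0             ≡⟨ stepSum-shift k g ⟩
    g 0                                         ∎
    where open ≡-Reasoning

  -- Periodic sequences

  HasPeriod : ℕ → Series → Set
  HasPeriod m f = ∀ n → f (m ℕ.+ n) ≡ f n

  HasPeriod-* : ∀ {m f} k → HasPeriod m f → HasPeriod (k ℕ.* m) f
  HasPeriod-* zero    per n = refl
  HasPeriod-* {m} {f} (suc k) per n =
    trans (cong f (ℕ.+-assoc m (k ℕ.* m) n)) (trans (per (k ℕ.* m ℕ.+ n)) (HasPeriod-* {m} {f} k per n))

  -- Bézout without subtraction: a multiple of one period exceeds a multiple of the other by 1, so a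
  -- step of 1 can be traded for steps by the two periods. The cases differ in which multiple is
  -- larger.
  HasPeriod-coprime : ∀ {m d f} → Coprime m d → HasPeriod m f → HasPeriod d f → HasPeriod 1 f
  HasPeriod-coprime {m} {d} {f} coprime perₘ perₔ n with coprime-Bézout coprime
  ... | Bézout.+- x y eq = begin
    f (1 ℕ.+ n)                  ≡⟨ HasPeriod-* {d} {f} y perₔ (1 ℕ.+ n) ⟨
    f (y ℕ.* d ℕ.+ (1 ℕ.+ n))    ≡⟨ cong f ([x+y]+z≡y+[x+z] 1 (y ℕ.* d) n) ⟨
    f (1 ℕ.+ y ℕ.* d ℕ.+ n)      ≡⟨ cong (λ k → f (k ℕ.+ n)) eq ⟩
    f (x ℕ.* m ℕ.+ n)            ≡⟨ HasPeriod-* {m} {f} x perₘ n ⟩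
    f n                          ∎
    where open ≡-Reasoning
  ... | Bézout.-+ x y eq = begin
    f (1 ℕ.+ n)                  ≡⟨ HasPeriod-* {m} {f} x perₘ (1 ℕ.+ n) ⟨
    f (x ℕ.* m ℕ.+ (1 ℕ.+ n))    ≡⟨ cong f ([x+y]+z≡y+[x+z] 1 (x ℕ.* m) n) ⟨
    f (1 ℕ.+ x ℕ.* m ℕ.+ n)      ≡⟨ cong (λ k → f (k ℕ.+ n)) eq ⟩
    f (y ℕ.* d ℕ.+ n)            ≡⟨ HasPeriod-* {d} {f} y perₔ n ⟩
    f n                          ∎
    where open ≡-Reasoning

  HasPeriod-1 : ∀ {f} → HasPeriod 1 f → ∀ n → f n ≡ f 0
  HasPeriod-1 per zero    = refl
  HasPeriod-1 per (suc n) = trans (per n) (HasPeriod-1 per n)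

  stepSum-period : ∀ d m {f k} → HasPeriod k f → HasPeriod k (stepSum d m f)
  stepSum-period d m {f} {k} per n =
    trans (sym (stepSum-translate d m k f n)) (stepSum-cong d m per n)

  -- The term entering the progression and the term leaving it are md apart, a period of f.
  stepSum-step-period : ∀ d m {f} → HasPeriod (m ℕ.* d) f → HasPeriod d (stepSum d m f)
  stepSum-step-period d m {f} per n = begin
    stepSum d m f (d ℕ.+ n)                          ≡⟨ stepSum-next d m f n ⟩
    stepSum d m f n + (f (m ℕ.* d ℕ.+ n) - f n)      ≡⟨ cong (λ x → stepSum d m f n + (x - f n)) (per n) ⟩
    stepSum d m f n + (f n - f n)                    ≡⟨ lemma (stepSum d m f n) (f n) ⟩
    stepSum d m f n                                  ∎
    where
    open ≡-Reasoning
    lemma : ∀ x y → x + (y - y) ≡ x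
    lemma = solve-∀

  cancel-nonZero : ∀ m .{{_ : NonZero m}} x → + m * x ≡ 0ℤ → x ≡ 0ℤ
  cancel-nonZero (suc m) x eq = ℤ.*-cancelˡ-≡ (+ suc m) x 0ℤ (trans eq (sym (ℤ.*-zeroʳ (+ suc m))))

  stepSum-zero : ∀ d m {f} → f ≗ (λ _ → 0ℤ) → stepSum d m f ≗ λ _ → 0ℤ
  stepSum-zero d m f≗0 n = trans (stepSum-cong d m f≗0 n) (trans (stepSum-const d m 0ℤ n) (ℤ.*-zeroʳ (+ m)))

  -- The progression sum g has both periods d and m, so it is constant, and its sum
  -- over m consecutive arguments vanishes because that of u does.
  stepSum-coprime : ∀ d m .{{_ : NonZero m}} {u} → Coprime m d → HasPeriod m u →
    stepSum 1 m u ≗ (λ _ → 0ℤ) → stepSum d m u ≗ λ _ → 0ℤ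
  stepSum-coprime d m {u} coprime per mean n = cancel-nonZero m (g n) (begin
    + m * g n                    ≡⟨ cong (+ m *_) (constant n) ⟩
    + m * g 0                    ≡⟨ stepSum-const 1 m (g 0) 0 ⟨
    stepSum 1 m (λ _ → g 0) 0    ≡⟨ stepSum-cong 1 m constant 0 ⟨
    stepSum 1 m g 0              ≡⟨ stepSum-comm 1 m d m u 0 ⟩
    stepSum d m (stepSum 1 m u) 0 ≡⟨ stepSum-zero d m mean 0 ⟩
    0ℤ                           ∎)
    where
    open ≡-Reasoning
    g : Series
    g = stepSum d m u
    m*d-period : HasPeriod (m ℕ.* d) u
    m*d-period = subst (λ k → HasPeriod k u) (ℕ.*-comm d m) (HasPeriod-* {m} {u} d per)
    constant : ∀ n → g n ≡ g 0
    constant = HasPeriod-1 (HasPeriod-coprime {m} {d} coprime (stepSum-period d m per) (stepSum-step-period d m m*d-period))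

  -- Iterated window sums

  windowSum : List ℕ → Series → Series
  windowSum []       f = f
  windowSum (a ∷ as) f = windowSum as (stepSum 1 a f)

  windowSum-cong : ∀ as {f g} → f ≗ g → windowSum as f ≗ windowSum as g
  windowSum-cong []       f≗g = f≗g
  windowSum-cong (a ∷ as) f≗g = windowSum-cong as (stepSum-cong 1 a f≗g)

  windowSum-linear : ∀ as k f g →
    windowSum as (λ n → k * f n + g n) ≗ λ n → k * windowSum as f n + windowSum as g n
  windowSum-linear []       k f g n = refl
  windowSum-linear (a ∷ as) k f g n =
    trans (windowSum-cong as (stepSum-linear 1 a k f g) n) (windowSum-linear as k (stepSum 1 a f) (stepSum 1 a g) n)

  windowSum-suc : ∀ as f → windowSum as (f ∘ suc) ≗ windowSum as f ∘ suc
  windowSum-suc []       f n = refl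
  windowSum-suc (a ∷ as) f n =
    trans (windowSum-cong as (stepSum-translate 1 a 1 f) n) (windowSum-suc as (stepSum 1 a f) n)

  windowSum-const : ∀ as k n → windowSum as (λ _ → k) n ≡ + product as * k
  windowSum-const []       k n = sym (ℤ.*-identityˡ k)
  windowSum-const (a ∷ as) k n = begin
    windowSum as (stepSum 1 a (λ _ → k)) n   ≡⟨ windowSum-cong as (stepSum-const 1 a k) n ⟩
    windowSum as (λ _ → + a * k) n           ≡⟨ windowSum-const as (+ a * k) n ⟩
    + product as * (+ a * k)                 ≡⟨ lemma (+ product as) (+ a) k ⟩
    + a * + product as * k                   ≡⟨ cong (_* k) (ℤ.pos-* a (product as)) ⟨
    + (a ℕ.* product as) * k                 ∎
    where
    open ≡-Reasoning
    lemma : ∀ p a k → p * (a * k) ≡ a * p * k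
    lemma = solve-∀

  windowSum-stepSum : ∀ as m f → windowSum as (stepSum 1 m f) ≗ stepSum 1 m (windowSum as f)
  windowSum-stepSum []       m f n = refl
  windowSum-stepSum (a ∷ as) m f n =
    trans (windowSum-cong as (stepSum-comm 1 a 1 m f) n) (windowSum-stepSum as m (stepSum 1 a f) n)

  VanishesBelow : ℕ → Series → Set
  VanishesBelow N f = ∀ n → n < N → f n ≡ 0ℤ

  shift-vanishes : ∀ N f → VanishesBelow N (shift N f)
  shift-vanishes (suc N) f zero    n<N       = refl
  shift-vanishes (suc N) f (suc n) (s≤s n<N) = shift-vanishes N f n n<N

  -- A nonempty window of length a that starts at n ≤ N ends at n + a - 1 < a + N, so the bound
  -- drops by a - 1 only.
  stepSum-vanishes : ∀ a N {f} → VanishesBelow (a ℕ.+ N) f → VanishesBelow (suc N) (stepSum 1 a f)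
  stepSum-vanishes zero    N van n n≤N = refl
  stepSum-vanishes (suc a) N {f} van n (s≤s n≤N) =
    cong₂ _+_
      (van n (s≤s (ℕ.≤-trans n≤N (ℕ.m≤n+m N a))))
      -- The rest of the window starts at `suc n` and is shorter by one, so a unit passes from the
      -- length to N.
      (stepSum-vanishes a (suc N) (subst (λ k → VanishesBelow k f) (sym (ℕ.+-suc a N)) van)
        (suc n) (s≤s (s≤s n≤N)))

  -- Each part a lowers the bound by a - 1, so of the sum of the parts their number is left.
  windowSum-vanishes : ∀ as N {f} → VanishesBelow (sum as ℕ.+ N) f → VanishesBelow (length as ℕ.+ N) (windowSum as f)
  windowSum-vanishes []       N van = van
  windowSum-vanishes (a ∷ as) N {f} van =
    subst (λ k → VanishesBelow k (windowSum (a ∷ as) f)) (ℕ.+-suc (length as) N)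
      (windowSum-vanishes as (suc N)
        (subst (λ k → VanishesBelow k (stepSum 1 a f)) (sym (ℕ.+-suc (sum as) N))
          (stepSum-vanishes a (sum as ℕ.+ N)
            (subst (λ k → VanishesBelow k f) (ℕ.+-assoc a (sum as) N) van))))

  -- Mean zero and the inductive step

  -- The vanishing of the iterated window sums is the form of "mean zero" that
  -- passes to the next function; see Balanced⇒stepSum for the mean over a period.
  record Balanced (as : List ℕ) (u : Series) : Set where
    field
      period : HasPeriod (product as) u
      mean   : windowSum as u ≗ λ _ → 0ℤ
  open Balanced

  -- The sum h over a period is constant, so the windows multiply it by the product m of the parts.
  -- Interchanging the sums lets the windows act on u, where they give 0; hence m h(0) = 0.
  Balanced⇒stepSum : ∀ as {u} .{{_ : NonZero (product as)}} → Balanced as u →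
    stepSum 1 (product as) u ≗ λ _ → 0ℤ
  Balanced⇒stepSum as {u} bal n = trans (constant n) (cancel-nonZero m (h 0) (begin
    + m * h 0                       ≡⟨ windowSum-const as (h 0) 0 ⟨
    windowSum as (λ _ → h 0) 0      ≡⟨ windowSum-cong as constant 0 ⟨
    windowSum as h 0                ≡⟨ windowSum-stepSum as m u 0 ⟩
    stepSum 1 m (windowSum as u) 0  ≡⟨ stepSum-zero 1 m (mean bal) 0 ⟩
    0ℤ                              ∎))
    where
    open ≡-Reasoning
    m = product as
    h = stepSum 1 m u
    constant : ∀ n → h n ≡ h 0
    constant = HasPeriod-1 (stepSum-step-period 1 m (subst (λ k → HasPeriod k u) (sym (ℕ.*-identityʳ m)) (period bal)))

  step-period : ∀ as d k {u u′} .{{_ : NonZero (product as)}} → Coprime (product as) d → Balanced as u →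
    (∀ n → u′ (d ℕ.+ n) ≡ u′ n + k * u n) → HasPeriod (product (d ∷ as)) u′
  step-period as d k {u} {u′} coprime bal step n = begin
    u′ (d ℕ.* product as ℕ.+ n)             ≡⟨ cong (λ m → u′ (m ℕ.+ n)) (ℕ.*-comm d (product as)) ⟩
    u′ (product as ℕ.* d ℕ.+ n)             ≡⟨ stepSum-telescope d (product as) k u u′ step n ⟩
    u′ n + k * stepSum d (product as) u n   ≡⟨ cong (λ x → u′ n + k * x) (stepSum-coprime d (product as) coprime (period bal) (Balanced⇒stepSum as bal) n) ⟩
    u′ n + k * 0ℤ                           ≡⟨ lemma (u′ n) k ⟩
    u′ n                                    ∎
    where
    open ≡-Reasoning
    lemma : ∀ x k → x + k * 0ℤ ≡ x
    lemma = solve-∀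

  -- Moving the window of length d by one changes the sum of u′ by u′(n + d) - u′(n) = k u(n), and
  -- the remaining windows annihilate u. So the full window sum of u′ is constant and its value at 0
  -- decides.
  step-Balanced : ∀ as d k {u u′} .{{_ : NonZero (product as)}} → Coprime (product as) d → Balanced as u →
    (∀ n → u′ (d ℕ.+ n) ≡ u′ n + k * u n) → windowSum (d ∷ as) u′ 0 ≡ 0ℤ → Balanced (d ∷ as) u′
  step-Balanced as d k {u} {u′} coprime bal step mean₀ = record
    { period = step-period as d k {u} {u′} coprime bal step
    ; mean   = λ n → trans (HasPeriod-1 constant n) mean₀
    }
    where
    open ≡-Reasoning
    next : ∀ n → stepSum 1 d u′ (suc n) ≡ k * u n + stepSum 1 d u′ n
    next n = begin
      stepSum 1 d u′ (suc n)                                   ≡⟨ stepSum-next 1 d u′ n ⟩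
      stepSum 1 d u′ n + (u′ (d ℕ.* 1 ℕ.+ n) - u′ n)           ≡⟨ cong (λ e → stepSum 1 d u′ n + (u′ (e ℕ.+ n) - u′ n)) (ℕ.*-identityʳ d) ⟩
      stepSum 1 d u′ n + (u′ (d ℕ.+ n) - u′ n)                 ≡⟨ cong (λ x → stepSum 1 d u′ n + (x - u′ n)) (step n) ⟩
      stepSum 1 d u′ n + (u′ n + k * u n - u′ n)               ≡⟨ lemma (stepSum 1 d u′ n) (u′ n) (k * u n) ⟩
      k * u n + stepSum 1 d u′ n                               ∎
      where
      lemma : ∀ x y z → x + (y + z - y) ≡ z + x
      lemma = solve-∀
    constant : HasPeriod 1 (windowSum (d ∷ as) u′)
    constant n = begin
      windowSum as (stepSum 1 d u′) (suc n)                     ≡⟨ windowSum-suc as (stepSum 1 d u′) n ⟨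
      windowSum as (stepSum 1 d u′ ∘ suc) n                     ≡⟨ windowSum-cong as next n ⟩
      windowSum as (λ i → k * u i + stepSum 1 d u′ i) n         ≡⟨ windowSum-linear as k u (stepSum 1 d u′) n ⟩
      k * windowSum as u n + windowSum as (stepSum 1 d u′) n    ≡⟨ cong (λ x → k * x + windowSum as (stepSum 1 d u′) n) (mean bal n) ⟩
      k * 0ℤ + windowSum as (stepSum 1 d u′) n                  ≡⟨ lemma k _ ⟩
      windowSum as (stepSum 1 d u′) n                           ∎
      where
      lemma : ∀ k x → k * 0ℤ + x ≡ x
      lemma = solve-∀

  -- Padded coefficients

  -- The coefficients of q^(σ ∸ 1) · g, where σ is the sum of as.
  padded : List ℕ → Series → Series
  padded as g = shift (sum as) g ∘ suc

  -- This compares the coefficients of q^(n + 1) in q^σ g = q^(d + σ) g + q^σ f, with σ the sum of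
  -- `as`. The padding zeros absorb the initial conditions, so that no n is exceptional.
  padded-step : ∀ d as f g → (1-q^ d) ⊛ g ≗ f →
    ∀ n → padded (d ∷ as) g (d ℕ.+ n) ≡ padded (d ∷ as) g n + padded as f n
  padded-step d as f g eq n = trans (shift-+ d (sum as) g n) (shift-1-q^ d (sum as) f g eq (suc n))

  -- `padded` at 0 is the shifted series at 1. The window sums for k parts still vanish below k, and
  -- two parts are enough to cover the index 1.
  padded-windowSum : ∀ a b as g → windowSum (a ∷ b ∷ as) (padded (a ∷ b ∷ as) g) 0 ≡ 0ℤ
  padded-windowSum a b as g =
    trans (windowSum-suc (a ∷ b ∷ as) (shift σ g) 0)
          (windowSum-vanishes (a ∷ b ∷ as) 0
            (subst (λ N → VanishesBelow N (shift σ g)) (sym (ℕ.+-identityʳ σ)) (shift-vanishes σ g))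
            1 (s≤s (s≤s z≤n)))
    where
    σ : ℕ
    σ = sum (a ∷ b ∷ as)

  -- The window consists of a - 1 padding zeros followed by g(0) = 1.
  padded-windowSum₁ : ∀ a .{{_ : NonZero a}} g → (1-q^ a) ⊛ g ≗ one → stepSum 1 a (padded (a ∷ []) g) 0 ≡ 1ℤ
  padded-windowSum₁ (suc a) g eq rewrite ℕ.+-identityʳ a =
    trans (stepSum-shift a g) (trans (1-q^-⊛ (suc a) g 0) (cong (_+_ 0ℤ) (eq 0)))

  -- Window sums of polynomials

  linearPoly : (k e : ℤ) → Series
  linearPoly k e n = k * (+ 2 * + n + e)

  quadraticPoly : (k e g : ℤ) → Series
  quadraticPoly k e g n = k * (+ 3 * ((+ 2 * + n + e) * (+ 2 * + n + e)) - g)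

  -- The mean of y = 2n + e over a window of length a is its value at the centre, which is y + a -
  -- 1; the doubled n keeps this an integer.
  stepSum-linearPoly : ∀ a k e → stepSum 1 a (linearPoly k e) ≗ linearPoly (k * + a) (e + + a - 1ℤ)
  stepSum-linearPoly zero    k e n = lemma k e (+ n)
    where
    lemma : ∀ k e n → 0ℤ ≡ k * 0ℤ * (+ 2 * n + (e + 0ℤ - 1ℤ))
    lemma = solve-∀
  stepSum-linearPoly (suc a) k e n =
    trans (cong (_+_ (linearPoly k e n)) (stepSum-linearPoly a k e (suc n))) (lemma k e (+ a) (+ n))
    where
    lemma : ∀ k e a n → k * (+ 2 * n + e) + k * a * (+ 2 * (1ℤ + n) + (e + a - 1ℤ))
                      ≡ k * (1ℤ + a) * (+ 2 * n + (e + (1ℤ + a) - 1ℤ))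
    lemma = solve-∀

  -- The numbers 0, 2, ..., 2(a - 1) have variance (a² - 1)/3. The factor 3 in `quadraticPoly` turns
  -- this into an integer correction of g.
  stepSum-quadraticPoly : ∀ a k e g →
    stepSum 1 a (quadraticPoly k e g) ≗ quadraticPoly (k * + a) (e + + a - 1ℤ) (g + 1ℤ - + a * + a)
  stepSum-quadraticPoly zero    k e g n = lemma k e g (+ n)
    where
    lemma : ∀ k e g n → 0ℤ ≡ k * 0ℤ * (+ 3 * ((+ 2 * n + (e + 0ℤ - 1ℤ)) * (+ 2 * n + (e + 0ℤ - 1ℤ))) - (g + 1ℤ - 0ℤ * 0ℤ))
    lemma = solve-∀
  stepSum-quadraticPoly (suc a) k e g n =
    trans (cong (_+_ (quadraticPoly k e g n)) (stepSum-quadraticPoly a k e g (suc n))) (lemma k e g (+ a) (+ n))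
    where
    lemma : ∀ k e g a n →
      k * (+ 3 * ((+ 2 * n + e) * (+ 2 * n + e)) - g)
        + k * a * (+ 3 * ((+ 2 * (1ℤ + n) + (e + a - 1ℤ)) * (+ 2 * (1ℤ + n) + (e + a - 1ℤ))) - (g + 1ℤ - a * a))
      ≡ k * (1ℤ + a) * (+ 3 * ((+ 2 * n + (e + (1ℤ + a) - 1ℤ)) * (+ 2 * n + (e + (1ℤ + a) - 1ℤ)))
        - (g + 1ℤ - (1ℤ + a) * (1ℤ + a)))
    lemma = solve-∀

  -- Denominators with four pairwise coprime parts

  -- A common divisor e of mn and k is prime to m, as every divisor of e divides k; hence e divides
  -- n.
  coprime-* : ∀ {m n k} → Coprime m k → Coprime n k → Coprime (m ℕ.* n) k
  coprime-* m⊥k n⊥k (e∣mn , e∣k) =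
    n⊥k (coprime-divisor (λ (x∣e , x∣m) → m⊥k (x∣m , ∣-trans x∣e e∣k)) e∣mn , e∣k)

  -- 48abcd g(n) minus the polynomial y³ − (a² + b² + c² + d²) y in y = 2n + a + b + c + d.
  remainderℤ : (a b c d n gₙ : ℤ) → ℤ
  remainderℤ a b c d n gₙ = + 48 * (a * b * c * d) * gₙ - (y * y * y - q * y)
    where
    y q : ℤ
    y = + 2 * n + (a + b + c + d)
    q = a * a + b * b + c * c + d * d

  remainder : (a b c d : ℕ) → Series → Series
  remainder a b c d g n = remainderℤ (+ a) (+ b) (+ c) (+ d) (+ n) (g n)

  -- The parts enter in the order a, b, c, d. `remainder` is `u₄` read from the index σ - 1 on,
  -- where the padding ends, so it inherits the period of `u₄`.
  remainder-period : ∀ a b c d g .{{_ : NonZero a}} .{{_ : NonZero b}} .{{_ : NonZero c}} .{{_ : NonZero d}} →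
    AllPairs Coprime (a ∷ b ∷ c ∷ d ∷ []) →
    ((1-q^ a) ⊛ (1-q^ b) ⊛ (1-q^ c) ⊛ (1-q^ d)) ⊛ g ≗ one →
    HasPeriod (a ℕ.* b ℕ.* c ℕ.* d) (remainder a b c d g)
  remainder-period a b c d g ((a⊥b ∷ a⊥c ∷ a⊥d ∷ []) ∷ (b⊥c ∷ b⊥d ∷ []) ∷ (c⊥d ∷ []) ∷ [] ∷ []) inverse n = begin
    remainder a b c d g (a ℕ.* b ℕ.* c ℕ.* d ℕ.+ n)              ≡⟨ u₄-remainder (a ℕ.* b ℕ.* c ℕ.* d ℕ.+ n) ⟨
    u₄ (σ′ ℕ.+ (a ℕ.* b ℕ.* c ℕ.* d ℕ.+ n))                      ≡⟨ cong u₄ index ⟩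
    u₄ (product (d ∷ c ∷ b ∷ a ∷ []) ℕ.+ (σ′ ℕ.+ n))             ≡⟨ period₄ (σ′ ℕ.+ n) ⟩
    u₄ (σ′ ℕ.+ n)                                                ≡⟨ u₄-remainder n ⟩
    remainder a b c d g n                                        ∎
    where
    open ≡-Reasoning
    A B C D : ℤ
    A = + a
    B = + b
    C = + c
    D = + d

    -- The series for fewer parts come from multiplying g by the factors of the later parts, so that
    -- the relations between neighbours hold by `refl`.
    g₁ g₂ g₃ : Series
    g₃ = (1-q^ d) ⊛ g
    g₂ = (1-q^ c) ⊛ g₃
    g₁ = (1-q^ b) ⊛ g₂

    g₁-inverse : (1-q^ a) ⊛ g₁ ≗ one
    g₁-inverse n = begin
      ((1-q^ a) ⊛ g₁) n                                           ≡⟨ ⊛-assoc (1-q^ a) (1-q^ b) g₂ n ⟨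
      ((1-q^ a) ⊛ (1-q^ b) ⊛ g₂) n                                ≡⟨ ⊛-assoc ((1-q^ a) ⊛ (1-q^ b)) (1-q^ c) g₃ n ⟨
      ((1-q^ a) ⊛ (1-q^ b) ⊛ (1-q^ c) ⊛ g₃) n                     ≡⟨ ⊛-assoc ((1-q^ a) ⊛ (1-q^ b) ⊛ (1-q^ c)) (1-q^ d) g n ⟨
      ((1-q^ a) ⊛ (1-q^ b) ⊛ (1-q^ c) ⊛ (1-q^ d) ⊛ g) n           ≡⟨ inverse n ⟩
      one n                                                       ∎

    v₁ v₂ v₃ v₄ : Series
    v₁ = padded (a ∷ []) g₁
    v₂ = padded (b ∷ a ∷ []) g₂
    v₃ = padded (c ∷ b ∷ a ∷ []) g₃
    v₄ = padded (d ∷ c ∷ b ∷ a ∷ []) g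

    e₂ e₃ e₄ q₃ q₄ : ℤ
    -- These are 2 - σ for the parts used so far, bracketed the way the cast of `sum` unfolds.
    e₂ = + 2 - (B + (A + 0ℤ))
    e₃ = + 2 - (C + (B + (A + 0ℤ)))
    e₄ = + 2 - (D + (C + (B + (A + 0ℤ))))
    q₃ = A * A + B * B + C * C
    q₄ = q₃ + D * D

    -- The polynomials subtracted in `u₁` to `u₄` are the residues at z = 0 of exp(yz/2) / ∏ 2
    -- sinh(aᵢz/2), multiplied by the product of the parts and by 1, 2, 24, 48 to clear
    -- denominators.
    u₀ u₁ u₂ u₃ u₄ : Series
    u₀ n = 0ℤ
    u₁ n = A * v₁ n + - 1ℤ
    u₂ n = + 2 * A * B * v₂ n + linearPoly (- 1ℤ) e₂ n
    u₃ n = + 24 * A * B * C * v₃ n + quadraticPoly (- 1ℤ) e₃ q₃ n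
    u₄ n = + 48 * (A * B * C * D) * v₄ n - (y * y * y - q₄ * y)
      where y = + 2 * + n + e₄

    -- `padded [] one` is the tail of `one` and vanishes, so `v₁` already has period a.
    step₁ : ∀ n → u₁ (a ℕ.+ n) ≡ u₁ n + 0ℤ * u₀ n
    step₁ n rewrite padded-step a [] one g₁ g₁-inverse n = lemma A (v₁ n)
      where
      lemma : ∀ A v → A * (v + 0ℤ) + - 1ℤ ≡ A * v + - 1ℤ + 0ℤ * 0ℤ
      lemma = solve-∀

    -- The factor is the ratio of the coefficients of the v, here 2AB / A, later 12C and 2D. With y
    -- taken for the previous parts, the new y runs from y - b to y + b.
    step₂ : ∀ n → u₂ (b ℕ.+ n) ≡ u₂ n + + 2 * B * u₁ n
    step₂ n rewrite padded-step b (a ∷ []) g₁ g₂ (λ _ → refl) n = lemma A B (v₂ n) (v₁ n) (+ n)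
      where
      lemma : ∀ A B v w n →
        + 2 * A * B * (v + w) + - 1ℤ * (+ 2 * (B + n) + (+ 2 - (B + (A + 0ℤ))))
        ≡ + 2 * A * B * v + - 1ℤ * (+ 2 * n + (+ 2 - (B + (A + 0ℤ)))) + + 2 * B * (A * w + - 1ℤ)
      lemma = solve-∀

    -- For the polynomials, 3(y + c)² - 3(y - c)² = 12cy.
    step₃ : ∀ n → u₃ (c ℕ.+ n) ≡ u₃ n + + 12 * C * u₂ n
    step₃ n rewrite padded-step c (b ∷ a ∷ []) g₂ g₃ (λ _ → refl) n = lemma A B C (v₃ n) (v₂ n) (+ n)
      where
      lemma : ∀ A B C v w n →
        + 24 * A * B * C * (v + w)
          + - 1ℤ * (+ 3 * ((+ 2 * (C + n) + (+ 2 - (C + (B + (A + 0ℤ))))) * (+ 2 * (C + n) + (+ 2 - (C + (B + (A + 0ℤ)))))) - (A * A + B * B + C * C))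
        ≡ + 24 * A * B * C * v
          + - 1ℤ * (+ 3 * ((+ 2 * n + (+ 2 - (C + (B + (A + 0ℤ))))) * (+ 2 * n + (+ 2 - (C + (B + (A + 0ℤ)))))) - (A * A + B * B + C * C))
          + + 12 * C * (+ 2 * A * B * w + - 1ℤ * (+ 2 * n + (+ 2 - (B + (A + 0ℤ)))))
      lemma = solve-∀

    -- (y + d)³ - (y - d)³ = 2d(3y² + d²), and subtracting 2d(q₃ + d²) leaves 2d(3y² - q₃).
    step₄ : ∀ n → u₄ (d ℕ.+ n) ≡ u₄ n + + 2 * D * u₃ n
    step₄ n rewrite padded-step d (c ∷ b ∷ a ∷ []) g₃ g (λ _ → refl) n =
      lemma A B C D (v₄ n) (v₃ n) (+ n) (A * A + B * B + C * C)
      where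
      lemma : ∀ A B C D v w n q →
        + 48 * (A * B * C * D) * (v + w)
          - ((+ 2 * (D + n) + (+ 2 - (D + (C + (B + (A + 0ℤ)))))) * (+ 2 * (D + n) + (+ 2 - (D + (C + (B + (A + 0ℤ)))))) * (+ 2 * (D + n) + (+ 2 - (D + (C + (B + (A + 0ℤ))))))
            - (q + D * D) * (+ 2 * (D + n) + (+ 2 - (D + (C + (B + (A + 0ℤ)))))))
        ≡ + 48 * (A * B * C * D) * v
          - ((+ 2 * n + (+ 2 - (D + (C + (B + (A + 0ℤ)))))) * (+ 2 * n + (+ 2 - (D + (C + (B + (A + 0ℤ)))))) * (+ 2 * n + (+ 2 - (D + (C + (B + (A + 0ℤ))))))
            - (q + D * D) * (+ 2 * n + (+ 2 - (D + (C + (B + (A + 0ℤ)))))))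
          + + 2 * D * (+ 24 * A * B * C * w
          + - 1ℤ * (+ 3 * ((+ 2 * n + (+ 2 - (C + (B + (A + 0ℤ))))) * (+ 2 * n + (+ 2 - (C + (B + (A + 0ℤ)))))) - q))
      lemma = solve-∀

    mean₁ : windowSum (a ∷ []) u₁ 0 ≡ 0ℤ
    mean₁ = begin
      stepSum 1 a u₁ 0                                        ≡⟨ stepSum-linear 1 a A v₁ (λ _ → - 1ℤ) 0 ⟩
      A * stepSum 1 a v₁ 0 + stepSum 1 a (λ _ → - 1ℤ) 0       ≡⟨ cong₂ (λ x y → A * x + y) (padded-windowSum₁ a g₁ g₁-inverse) (stepSum-const 1 a (- 1ℤ) 0) ⟩
      A * 1ℤ + A * - 1ℤ                                       ≡⟨ lemma A ⟩
      0ℤ                                                      ∎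
      where
      lemma : ∀ A → A * 1ℤ + A * - 1ℤ ≡ 0ℤ
      lemma = solve-∀

    mean₂ : windowSum (b ∷ a ∷ []) u₂ 0 ≡ 0ℤ
    mean₂ = begin
      windowSum (b ∷ a ∷ []) u₂ 0
        ≡⟨ windowSum-linear (b ∷ a ∷ []) k v₂ (linearPoly (- 1ℤ) e₂) 0 ⟩
      k * windowSum (b ∷ a ∷ []) v₂ 0 + stepSum 1 a (stepSum 1 b (linearPoly (- 1ℤ) e₂)) 0
        ≡⟨ cong₂ (λ x y → k * x + y) (padded-windowSum b a [] g₂)
             (trans (stepSum-cong 1 a (stepSum-linearPoly b (- 1ℤ) e₂) 0) (stepSum-linearPoly a (- 1ℤ * B) (e₂ + B - 1ℤ) 0)) ⟩
      k * 0ℤ + linearPoly (- 1ℤ * B * A) (e₂ + B - 1ℤ + A - 1ℤ) 0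
        -- The windows move 2 - σ by b - 1 and a - 1, to 0.
        ≡⟨ lemma k A B ⟩
      0ℤ ∎
      where
      k = + 2 * A * B
      lemma : ∀ k A B → k * 0ℤ + - 1ℤ * B * A * (+ 2 * 0ℤ + (+ 2 - (B + (A + 0ℤ)) + B - 1ℤ + A - 1ℤ)) ≡ 0ℤ
      lemma = solve-∀

    mean₃ : windowSum (c ∷ b ∷ a ∷ []) u₃ 0 ≡ 0ℤ
    mean₃ = begin
      windowSum (c ∷ b ∷ a ∷ []) u₃ 0
        ≡⟨ windowSum-linear (c ∷ b ∷ a ∷ []) k v₃ (quadraticPoly (- 1ℤ) e₃ q₃) 0 ⟩
      k * windowSum (c ∷ b ∷ a ∷ []) v₃ 0 + stepSum 1 a (stepSum 1 b (stepSum 1 c (quadraticPoly (- 1ℤ) e₃ q₃))) 0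
        ≡⟨ cong₂ (λ x y → k * x + y) (padded-windowSum c b (a ∷ []) g₃)
             (trans (stepSum-cong 1 a (λ n → trans (stepSum-cong 1 b (stepSum-quadraticPoly c (- 1ℤ) e₃ q₃) n)
                                                   (stepSum-quadraticPoly b (- 1ℤ * C) (e₃ + C - 1ℤ) (q₃ + 1ℤ - C * C) n)) 0)
                    (stepSum-quadraticPoly a (- 1ℤ * C * B) (e₃ + C - 1ℤ + B - 1ℤ) (q₃ + 1ℤ - C * C + 1ℤ - B * B) 0)) ⟩
      k * 0ℤ + quadraticPoly (- 1ℤ * C * B * A) (e₃ + C - 1ℤ + B - 1ℤ + A - 1ℤ)
                         (q₃ + 1ℤ - C * C + 1ℤ - B * B + 1ℤ - A * A) 0
        -- The windows take 2 - σ to (2 - σ) + (σ - 3) = -1 and q₃ to 3, and 3 · (-1)² - 3 = 0.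
        ≡⟨ lemma k A B C ⟩
      0ℤ ∎
      where
      k = + 24 * A * B * C
      lemma : ∀ k A B C →
        k * 0ℤ + - 1ℤ * C * B * A *
          (+ 3 * ((+ 2 * 0ℤ + (+ 2 - (C + (B + (A + 0ℤ))) + C - 1ℤ + B - 1ℤ + A - 1ℤ)) * (+ 2 * 0ℤ + (+ 2 - (C + (B + (A + 0ℤ))) + C - 1ℤ + B - 1ℤ + A - 1ℤ)))
            - (A * A + B * B + C * C + 1ℤ - C * C + 1ℤ - B * B + 1ℤ - A * A)) ≡ 0ℤ
      lemma = solve-∀

    instance
      nz₁ : NonZero (product (a ∷ []))
      nz₁ = ℕ.m*n≢0 a 1
      nz₂ : NonZero (product (b ∷ a ∷ []))
      nz₂ = ℕ.m*n≢0 b (product (a ∷ []))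
      nz₃ : NonZero (product (c ∷ b ∷ a ∷ []))
      nz₃ = ℕ.m*n≢0 c (product (b ∷ a ∷ []))

    balanced₀ : Balanced [] u₀
    balanced₀ = record { period = λ _ → refl ; mean = λ _ → refl }

    balanced₁ : Balanced (a ∷ []) u₁
    balanced₁ = step-Balanced [] a 0ℤ (1-coprimeTo a) balanced₀ step₁ mean₁

    balanced₂ : Balanced (b ∷ a ∷ []) u₂
    balanced₂ = step-Balanced (a ∷ []) b (+ 2 * B) (coprime-* a⊥b (1-coprimeTo b)) balanced₁ step₂ mean₂

    balanced₃ : Balanced (c ∷ b ∷ a ∷ []) u₃
    balanced₃ = step-Balanced (b ∷ a ∷ []) c (+ 12 * C)
      (coprime-* b⊥c (coprime-* a⊥c (1-coprimeTo c))) balanced₂ step₃ mean₃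

    period₄ : HasPeriod (product (d ∷ c ∷ b ∷ a ∷ [])) u₄
    period₄ = step-period (c ∷ b ∷ a ∷ []) d (+ 2 * D) {u₃} {u₄}
      (coprime-* c⊥d (coprime-* b⊥d (coprime-* a⊥d (1-coprimeTo d)))) balanced₃ step₄

    σ σ′ : ℕ
    σ = sum (d ∷ c ∷ b ∷ a ∷ [])
    σ′ = ℕ.pred σ

    suc-σ′ : suc σ′ ≡ σ
    suc-σ′ = ℕ.suc-pred σ {{ℕ.≢-nonZero λ σ≡0 → ℕ.≢-nonZero⁻¹ d (ℕ.m+n≡0⇒m≡0 d σ≡0)}}

    u₄-remainder : ∀ n → u₄ (σ′ ℕ.+ n) ≡ remainder a b c d g n
    u₄-remainder n = cong₂ (λ v y → + 48 * (A * B * C * D) * v - (y * y * y - q₄ * y)) v≡ y≡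
      where
      v≡ : v₄ (σ′ ℕ.+ n) ≡ g n
      v≡ = trans (cong (λ k → shift σ g (k ℕ.+ n)) suc-σ′) (shift-cancel σ g n)
      y≡ : + 2 * + (σ′ ℕ.+ n) + e₄ ≡ + 2 * + n + (A + B + C + D)
      y≡ = trans (lemma₁ (+ σ′) (+ n) (+ σ))
             (trans (cong (λ k → + 2 * + n + (+ 2 * + k - + σ)) suc-σ′) (lemma₂ (+ n) A B C D))
        where
        lemma₁ : ∀ s n t → + 2 * (s + n) + (+ 2 - t) ≡ + 2 * n + (+ 2 * (1ℤ + s) - t)
        lemma₁ = solve-∀
        lemma₂ : ∀ n A B C D → + 2 * n + (+ 2 * (D + (C + (B + (A + 0ℤ)))) - (D + (C + (B + (A + 0ℤ))))) ≡ + 2 * n + (A + B + C + D)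
        lemma₂ = solve-∀

    index : σ′ ℕ.+ (a ℕ.* b ℕ.* c ℕ.* d ℕ.+ n) ≡ product (d ∷ c ∷ b ∷ a ∷ []) ℕ.+ (σ′ ℕ.+ n)
    index = lemma a b c d σ′ n
      where
      lemma : ∀ a b c d s n → s ℕ.+ (a ℕ.* b ℕ.* c ℕ.* d ℕ.+ n) ≡ d ℕ.* (c ℕ.* (b ℕ.* (a ℕ.* 1))) ℕ.+ (s ℕ.+ n)
      lemma = ℕ-solve-∀

  -- Passage to ℚ

  fromℚᵘ-homo-+ : ∀ p q → fromℚᵘ (p ℚᵘ.+ q) ≡ fromℚᵘ p ℚ.+ fromℚᵘ q
  fromℚᵘ-homo-+ p q = ℚ.toℚᵘ-injective (begin
    ℚ.toℚᵘ (fromℚᵘ (p ℚᵘ.+ q))                     ≈⟨ ℚ.toℚᵘ-fromℚᵘ (p ℚᵘ.+ q) ⟩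
    p ℚᵘ.+ q                                       ≈⟨ ℚᵘ.+-cong (ℚ.toℚᵘ-fromℚᵘ p) (ℚ.toℚᵘ-fromℚᵘ q) ⟨
    ℚ.toℚᵘ (fromℚᵘ p) ℚᵘ.+ ℚ.toℚᵘ (fromℚᵘ q)       ≈⟨ ℚ.toℚᵘ-homo-+ (fromℚᵘ p) (fromℚᵘ q) ⟨
    ℚ.toℚᵘ (fromℚᵘ p ℚ.+ fromℚᵘ q)                 ∎)
    where open ℚᵘ.≃-Reasoning

  fromℚᵘ-homo-* : ∀ p q → fromℚᵘ (p ℚᵘ.* q) ≡ fromℚᵘ p ℚ.* fromℚᵘ q
  fromℚᵘ-homo-* p q = ℚ.toℚᵘ-injective (begin
    ℚ.toℚᵘ (fromℚᵘ (p ℚᵘ.* q))                     ≈⟨ ℚ.toℚᵘ-fromℚᵘ (p ℚᵘ.* q) ⟩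
    p ℚᵘ.* q                                       ≈⟨ ℚᵘ.*-cong (ℚ.toℚᵘ-fromℚᵘ p) (ℚ.toℚᵘ-fromℚᵘ q) ⟨
    ℚ.toℚᵘ (fromℚᵘ p) ℚᵘ.* ℚ.toℚᵘ (fromℚᵘ q)       ≈⟨ ℚ.toℚᵘ-homo-* (fromℚᵘ p) (fromℚᵘ q) ⟨
    ℚ.toℚᵘ (fromℚᵘ p ℚ.* fromℚᵘ q)                 ∎)
    where open ℚᵘ.≃-Reasoning

  -- `fromℚᵘ` of an unnormalised fraction unfolds to the quotient in ℚ, so the claim reduces to an
  -- equality of cross products in ℤ, without gcds. The weights 8 and 4 are 48/6 and 48/(2 · 6).
  divide-48 : ∀ m .{{_ : NonZero m}} .{{_ : NonZero (6 ℕ.* m)}} .{{_ : NonZero (48 ℕ.* m)}} p x y c w →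
    + 48 * + m * p ≡ + 8 * x + + 4 * y + c + w →
    p / 1 ≡ (x / 1 ℚ.+ y / 2) ℚ.* (1ℤ / (6 ℕ.* m)) ℚ.+ c / (48 ℕ.* m) ℚ.+ w / (48 ℕ.* m)
  divide-48 (suc m) p x y c w eq = begin
    fromℚᵘ p′                                                                    ≡⟨ ℚ.fromℚᵘ-cong {p′} {(x′ ℚᵘ.+ y′) ℚᵘ.* m′ ℚᵘ.+ c′ ℚᵘ.+ w′} (*≡* cross) ⟩
    fromℚᵘ ((x′ ℚᵘ.+ y′) ℚᵘ.* m′ ℚᵘ.+ c′ ℚᵘ.+ w′)                                ≡⟨ fromℚᵘ-homo-+ ((x′ ℚᵘ.+ y′) ℚᵘ.* m′ ℚᵘ.+ c′) w′ ⟩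
    fromℚᵘ ((x′ ℚᵘ.+ y′) ℚᵘ.* m′ ℚᵘ.+ c′) ℚ.+ fromℚᵘ w′                          ≡⟨ cong (ℚ._+ fromℚᵘ w′) (fromℚᵘ-homo-+ ((x′ ℚᵘ.+ y′) ℚᵘ.* m′) c′) ⟩
    fromℚᵘ ((x′ ℚᵘ.+ y′) ℚᵘ.* m′) ℚ.+ fromℚᵘ c′ ℚ.+ fromℚᵘ w′                    ≡⟨ cong (λ z → z ℚ.+ fromℚᵘ c′ ℚ.+ fromℚᵘ w′) (fromℚᵘ-homo-* (x′ ℚᵘ.+ y′) m′) ⟩
    fromℚᵘ (x′ ℚᵘ.+ y′) ℚ.* fromℚᵘ m′ ℚ.+ fromℚᵘ c′ ℚ.+ fromℚᵘ w′                ≡⟨ cong (λ z → z ℚ.* fromℚᵘ m′ ℚ.+ fromℚᵘ c′ ℚ.+ fromℚᵘ w′) (fromℚᵘ-homo-+ x′ y′) ⟩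
    (fromℚᵘ x′ ℚ.+ fromℚᵘ y′) ℚ.* fromℚᵘ m′ ℚ.+ fromℚᵘ c′ ℚ.+ fromℚᵘ w′          ∎
    where
    open ≡-Reasoning
    p′ = mkℚᵘ p 0
    x′ = mkℚᵘ x 0
    y′ = mkℚᵘ y 1
    m′ = mkℚᵘ 1ℤ (ℕ.pred (6 ℕ.* suc m))
    c′ = mkℚᵘ c (ℕ.pred (48 ℕ.* suc m))
    w′ = mkℚᵘ w (ℕ.pred (48 ℕ.* suc m))
    M = + suc m
    E = + 6 * M
    F = + 48 * M
    E≡ : + (6 ℕ.* suc m) ≡ E
    E≡ = ℤ.pos-* 6 (suc m)
    F≡ : + (48 ℕ.* suc m) ≡ F
    F≡ = ℤ.pos-* 48 (suc m)
    D₁ : + (2 ℕ.* (6 ℕ.* suc m)) ≡ + 2 * E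
    D₁ = trans (ℤ.pos-* 2 (6 ℕ.* suc m)) (cong (+ 2 *_) E≡)
    D₂ : + (2 ℕ.* (6 ℕ.* suc m) ℕ.* (48 ℕ.* suc m)) ≡ + 2 * E * F
    D₂ = trans (ℤ.pos-* (2 ℕ.* (6 ℕ.* suc m)) (48 ℕ.* suc m)) (cong₂ _*_ D₁ F≡)
    D₃ : + (2 ℕ.* (6 ℕ.* suc m) ℕ.* (48 ℕ.* suc m) ℕ.* (48 ℕ.* suc m)) ≡ + 2 * E * F * F
    D₃ = trans (ℤ.pos-* (2 ℕ.* (6 ℕ.* suc m) ℕ.* (48 ℕ.* suc m)) (48 ℕ.* suc m)) (cong₂ _*_ D₂ F≡)
    cross : p * + (2 ℕ.* (6 ℕ.* suc m) ℕ.* (48 ℕ.* suc m) ℕ.* (48 ℕ.* suc m))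
      ≡ (((x * + 2 + y * + 1) * 1ℤ * + (48 ℕ.* suc m) + c * + (2 ℕ.* (6 ℕ.* suc m))) * + (48 ℕ.* suc m)
          + w * + (2 ℕ.* (6 ℕ.* suc m) ℕ.* (48 ℕ.* suc m))) * + 1
    cross = begin
      p * + (2 ℕ.* (6 ℕ.* suc m) ℕ.* (48 ℕ.* suc m) ℕ.* (48 ℕ.* suc m))   ≡⟨ cong (p *_) D₃ ⟩
      -- One factor F = 48M is split off to match `eq`; 2EF stays as a common multiplier.
      p * (+ 2 * E * F * F)                                               ≡⟨ lemma₁ p M ⟩
      + 48 * M * p * (+ 2 * E * F)                                        ≡⟨ cong (_* (+ 2 * E * F)) eq ⟩
      (+ 8 * x + + 4 * y + c + w) * (+ 2 * E * F)                         ≡⟨ lemma₂ x y c w M ⟩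
      (((x * + 2 + y * + 1) * 1ℤ * F + c * (+ 2 * E)) * F + w * (+ 2 * E * F)) * + 1
        ≡⟨ cong₂ (λ f d → (((x * + 2 + y * + 1) * 1ℤ * f + c * d) * f + w * (d * f)) * + 1) F≡ D₁ ⟨
      (((x * + 2 + y * + 1) * 1ℤ * + (48 ℕ.* suc m) + c * + (2 ℕ.* (6 ℕ.* suc m))) * + (48 ℕ.* suc m)
          + w * (+ (2 ℕ.* (6 ℕ.* suc m)) * + (48 ℕ.* suc m))) * + 1
        ≡⟨ cong (λ d → (((x * + 2 + y * + 1) * 1ℤ * + (48 ℕ.* suc m) + c * + (2 ℕ.* (6 ℕ.* suc m))) * + (48 ℕ.* suc m) + w * d) * + 1)
             (ℤ.pos-* (2 ℕ.* (6 ℕ.* suc m)) (48 ℕ.* suc m)) ⟨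
      (((x * + 2 + y * + 1) * 1ℤ * + (48 ℕ.* suc m) + c * + (2 ℕ.* (6 ℕ.* suc m))) * + (48 ℕ.* suc m)
          + w * + (2 ℕ.* (6 ℕ.* suc m) ℕ.* (48 ℕ.* suc m))) * + 1         ∎
      where
      lemma₁ : ∀ p M → p * (+ 2 * (+ 6 * M) * (+ 48 * M) * (+ 48 * M)) ≡ + 48 * M * p * (+ 2 * (+ 6 * M) * (+ 48 * M))
      lemma₁ = solve-∀
      lemma₂ : ∀ x y c w M → (+ 8 * x + + 4 * y + c + w) * (+ 2 * (+ 6 * M) * (+ 48 * M))
        ≡ (((x * + 2 + y * + 1) * 1ℤ * (+ 48 * M) + c * (+ 2 * (+ 6 * M))) * (+ 48 * M) + w * (+ 2 * (+ 6 * M) * (+ 48 * M))) * + 1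
      lemma₂ = solve-∀

  -- The cubic polynomial for the parts s, r - s, r + s, 2r - s

  pos-∸ : ∀ {m n} → n ≤ m → + (m ℕ.∸ n) ≡ + m - + n
  pos-∸ {m} {n} n≤m = trans (sym (ℤ.⊖-≥ n≤m)) (sym (ℤ.m-n≡m⊖n m n))

  pos-^2 : ∀ n → + (n ^ 2) ≡ + n * + n
  pos-^2 n = trans (cong (λ k → + (n ℕ.* k)) (ℕ.*-identityʳ n)) (ℤ.pos-* n n)

  pos-^3 : ∀ n → + (n ^ 3) ≡ + n * (+ n * + n)
  pos-^3 n = trans (ℤ.pos-* n (n ^ 2)) (cong (+ n *_) (pos-^2 n))

  -- The value of y³ − (a² + b² + c² + d²) y at n = 0, that is at y = 4r.
  constant : ℕ → ℕ → ℤ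
  constant r s = + 64 * (+ r * + r * + r) - + 4 * + r * (+ 6 * (+ r * + r) - + 4 * (+ r * + s) + + 4 * (+ s * + s))

  -- For these parts y = 2n + 4r, and the squares of the parts add up to 6r² - 4rs + 4s². Expanding
  -- y³ minus this sum times y gives 8 and 4 times the two numerators in `P₃`, plus `constant`.
  decomposition : ∀ r s → s ≤ r → ∀ g n →
    + 48 * + Δ r s * g n
      ≡ + 8 * + (n ^ 3 ℕ.+ 6 ℕ.* n ^ 2 ℕ.* r)
        + + 4 * (+ n * (+ (21 ℕ.* r ^ 2 ℕ.+ 2 ℕ.* r ℕ.* s) - + (2 ℕ.* s ^ 2)))
        + constant r s
        + remainder s (r ℕ.∸ s) (r ℕ.+ s) (2 ℕ.* r ℕ.∸ s) g n
  decomposition r s s≤r g n = begin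
    + 48 * + Δ r s * g n
      ≡⟨ cong (λ x → + 48 * x * g n) Δ≡ ⟩
    + 48 * (S * (R - S) * (R + S) * (+ 2 * R - S)) * g n
      ≡⟨ lemma N R S (g n) ⟩
    + 8 * (N * (N * N) + + 6 * (N * N) * R)
      + + 4 * (N * (+ 21 * (R * R) + + 2 * R * S - + 2 * (S * S)))
      + constant r s
      + remainderℤ S (R - S) (R + S) (+ 2 * R - S) N (g n)
      ≡⟨ cong₂ _+_
           (cong (_+ constant r s)
             (cong₂ (λ x y → + 8 * x + + 4 * (N * y)) n-part (cong₂ _-_ r-part s-part)))
           (cong₂ (λ b d → remainderℤ S b (R + S) d N (g n)) b≡ d≡) ⟨
    + 8 * + (n ^ 3 ℕ.+ 6 ℕ.* n ^ 2 ℕ.* r)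
      + + 4 * (+ n * (+ (21 ℕ.* r ^ 2 ℕ.+ 2 ℕ.* r ℕ.* s) - + (2 ℕ.* s ^ 2)))
      + constant r s
      + remainder s (r ℕ.∸ s) (r ℕ.+ s) (2 ℕ.* r ℕ.∸ s) g n ∎
    where
    open ≡-Reasoning
    N R S : ℤ
    N = + n
    R = + r
    S = + s
    b≡ : + (r ℕ.∸ s) ≡ R - S
    b≡ = pos-∸ s≤r
    d≡ : + (2 ℕ.* r ℕ.∸ s) ≡ + 2 * R - S
    d≡ = trans (pos-∸ (ℕ.≤-trans s≤r (ℕ.m≤m+n r (1 ℕ.* r)))) (cong (_- S) (ℤ.pos-* 2 r))
    Δ≡ : + Δ r s ≡ S * (R - S) * (R + S) * (+ 2 * R - S)
    Δ≡ =
      trans (ℤ.pos-* (s ℕ.* (r ℕ.∸ s) ℕ.* (r ℕ.+ s)) (2 ℕ.* r ℕ.∸ s)) (cong₂ _*_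
        (trans (ℤ.pos-* (s ℕ.* (r ℕ.∸ s)) (r ℕ.+ s)) (cong (_* (R + S))
          (trans (ℤ.pos-* s (r ℕ.∸ s)) (cong (S *_) b≡))))
        d≡)
    n-part : + (n ^ 3 ℕ.+ 6 ℕ.* n ^ 2 ℕ.* r) ≡ N * (N * N) + + 6 * (N * N) * R
    n-part = cong₂ _+_ (pos-^3 n)
      (trans (ℤ.pos-* (6 ℕ.* n ^ 2) r) (cong (_* R) (trans (ℤ.pos-* 6 (n ^ 2)) (cong (+ 6 *_) (pos-^2 n)))))
    r-part : + (21 ℕ.* r ^ 2 ℕ.+ 2 ℕ.* r ℕ.* s) ≡ + 21 * (R * R) + + 2 * R * S
    r-part = cong₂ _+_ (trans (ℤ.pos-* 21 (r ^ 2)) (cong (+ 21 *_) (pos-^2 r)))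
      (trans (ℤ.pos-* (2 ℕ.* r) s) (cong (_* S) (ℤ.pos-* 2 r)))
    s-part : + (2 ℕ.* s ^ 2) ≡ + 2 * (S * S)
    s-part = trans (ℤ.pos-* 2 (s ^ 2)) (cong (+ 2 *_) (pos-^2 s))
    lemma : ∀ n r s g →
      + 48 * (s * (r - s) * (r + s) * (+ 2 * r - s)) * g
      ≡ + 8 * (n * (n * n) + + 6 * (n * n) * r)
        + + 4 * (n * (+ 21 * (r * r) + + 2 * r * s - + 2 * (s * s)))
        + (+ 64 * (r * r * r) - + 4 * r * (+ 6 * (r * r) - + 4 * (r * s) + + 4 * (s * s)))
        + (+ 48 * (s * (r - s) * (r + s) * (+ 2 * r - s)) * g
          - ((+ 2 * n + (s + (r - s) + (r + s) + (+ 2 * r - s))) * (+ 2 * n + (s + (r - s) + (r + s) + (+ 2 * r - s))) * (+ 2 * n + (s + (r - s) + (r + s) + (+ 2 * r - s)))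
            - (s * s + (r - s) * (r - s) + (r + s) * (r + s) + (+ 2 * r - s) * (+ 2 * r - s)) * (+ 2 * n + (s + (r - s) + (r + s) + (+ 2 * r - s)))))
    lemma = solve-∀

-- The formula for p₄

open import Data.Nat using (_*_)
open import Data.Rational using (_+_)

proposition3p1 : (r s : ℕ) (1≤s : 1 ≤ s) (2s<r : 2 * s < r) → AllPairs Coprime (parts r s) →
    Σ[ C₄ ∈ ℚ ] Σ[ Q ∈ (ℕ → ℚ) ] Periodic (Δ r s) Q
    × (∀ (n : ℕ) → p₄ r s n / 1 ≡ P₃ r s {{Δ-nonZero 1≤s 2s<r}} n + C₄ + Q n)
proposition3p1 r s 1≤s 2s<r coprime with a≢0 ∷ b≢0 ∷ c≢0 ∷ d≢0 ∷ [] ← parts-nonZero 1≤s 2s<r =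
  -- The witnesses are the term of the cubic that is constant in n and the remainder, each divided
  -- by 48Δ.
  constant r s / (48 * Δ r s) , (λ n → W n / (48 * Δ r s)) , periodic , λ n →
    divide-48 (Δ r s) (p₄ r s n) (+ (n ^ 3 ℕ.+ 6 * n ^ 2 * r))
      (+ n ℤ.* (+ (21 * r ^ 2 ℕ.+ 2 * r * s) ℤ.- + (2 * s ^ 2))) (constant r s) (W n)
      (decomposition r s s≤r (p₄ r s) n)
  where
  instance
    Δ≢0 : NonZero (Δ r s)
    Δ≢0 = Δ-nonZero 1≤s 2s<r
    6Δ≢0 : NonZero (6 * Δ r s)
    6Δ≢0 = ℕ.m*n≢0 6 (Δ r s)
    48Δ≢0 : NonZero (48 * Δ r s)
    48Δ≢0 = ℕ.m*n≢0 48 (Δ r s)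

  s≤r : s ≤ r
  s≤r = ℕ.≤-trans (ℕ.m≤m+n s (1 * s)) (ℕ.<⇒≤ 2s<r)

  W : ℕ → ℤ
  W = remainder s (r ℕ.∸ s) (r ℕ.+ s) (2 * r ℕ.∸ s) (p₄ r s)

  periodic : Periodic (Δ r s) (λ n → W n / (48 * Δ r s))
  -- `Periodic` adds the period on the right, `HasPeriod` on the left.
  periodic n = cong (_/ (48 * Δ r s)) (trans (cong W (ℕ.+-comm n (Δ r s)))
    (remainder-period s (r ℕ.∸ s) (r ℕ.+ s) (2 * r ℕ.∸ s) (p₄ r s)
      {{a≢0}} {{b≢0}} {{c≢0}} {{d≢0}} coprime (p₄-correct 1≤s 2s<r) n))
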